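{- Let $k$ be a positive integer. For every natural number $n$, $$q_{2k}(8n+2k)=\delta_{2k}(n)=\sum_{\substack{a,b\in\mathbb{N}_0\\ a+2b=n}}r_k(a)\,\delta_k(b)=\sum_{\substack{a,b\in\mathbb{N}_0\\ a+2b=n}}r_k(a)\,q_k(8b+k).$$
   Context: $\mathbb{N}_0=\{0,1,2,\dots\}$. For $m\in\mathbb{N}_0$ and a positive integer $j$: $r_j(m)=\#\{\mathbf{y}\in\mathbb{Z}^j: m=\sum_{i=1}^j y_i^2\}$; $\delta_j(m)=\#\{\mathbf{z}\in\mathbb{N}_0^j: m=\sum_{i=1}^j\frac{z_i(z_i+1)}{2}\}$; $q_j(m)=\#\{\mathbf{y}\in\mathbb{Z}^j: m=\sum_{i=1}^j y_i^2,\ y_i\ge 0,\ y_i\text{ odd}\}$. -}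

module Defs where

open import Data.Nat as ℕ using (ℕ; zero; suc; z≤n; s≤s; _/_)
import Data.Nat.Properties as ℕ
open import Data.Nat.DivMod using (m*n/n≡m; /-monoˡ-≤)
open import Data.Nat.ListAction using (sum)
open import Data.Integer as ℤ using (ℤ; +_; -[1+_]; 0ℤ; ∣_∣)
import Data.Integer.Properties as ℤ
open import Data.Integer.Divisibility using (_∣_)
import Data.Nat.Divisibility as ℕ using (_∣?_)
open import Data.List as List using (List; []; _∷_; _++_; upTo; filter; cartesianProduct; cartesianProductWith)
open import Data.List.Membership.Propositional using (_∈_)
open import Data.List.Membership.Propositional.Properties
  using (∈-filter⁺; ∈-filter⁻; ∈-map⁺; ∈-map⁻; ∈-++⁺ˡ; ∈-++⁺ʳ; ∈-upTo⁺; ∈-cartesianProduct⁺; ∈-cartesianProductWith⁺)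
open import Data.List.Relation.Unary.Any using (here)
import Data.List.Relation.Unary.All as ListAll
import Data.List.Relation.Unary.AllPairs as AllPairs
open import Data.List.Relation.Unary.Unique.Propositional using (Unique)
import Data.List.Relation.Unary.Unique.Propositional.Properties as Unique
open import Data.Vec as Vec using (Vec; []; _∷_)
open import Data.Vec.Properties using (∷-injective)
open import Data.Vec.Relation.Unary.All as All using (All; []; _∷_)
open import Data.Product using (_×_; _,_; proj₁; proj₂)
open import Level using (0ℓ)
open import Relation.Nullary using (¬_)
open import Relation.Nullary.Decidable using (¬?; _×-dec_)
open import Relation.Unary using (Pred; Decidable)
open import Relation.Binary.PropositionalEquality using (_≡_; refl; sym; trans; cong; cong₂; subst)

-- A duplicate-free list of exactly the elements satisfying P.  Any two such
-- lists are permutations of each other, so # and ∑ below depend only on P.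
record Finite {A : Set} (P : Pred A 0ℓ) : Set where
  field
    elements : List A
    unique   : Unique elements
    sound    : ∀ {x} → x ∈ elements → P x
    complete : ∀ {x} → P x → x ∈ elements

open Finite public

# : {A : Set} {P : Pred A 0ℓ} → Finite P → ℕ
# F = List.length (elements F)

∑ : {A : Set} {P : Pred A 0ℓ} → Finite P → (A → ℕ) → ℕ
∑ F f = sum (List.map f (elements F))

sumℤ : ∀ {j} → Vec ℤ j → ℤ
sumℤ = Vec.foldr _ ℤ._+_ 0ℤ

triangular : ℕ → ℕ
triangular z = z ℕ.* (z ℕ.+ 1) / 2

SquareRep : (j m : ℕ) → Pred (Vec ℤ j) 0ℓ
SquareRep j m y = + m ≡ sumℤ (Vec.map (ℤ._^ 2) y)

TriangularRep : (j m : ℕ) → Pred (Vec ℕ j) 0ℓ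
TriangularRep j m z = m ≡ Vec.sum (Vec.map triangular z)

Odd : Pred ℤ 0ℓ
Odd i = ¬ (+ 2 ∣ i)

OddSquareRep : (j m : ℕ) → Pred (Vec ℤ j) 0ℓ
OddSquareRep j m y = SquareRep j m y × All (λ i → 0ℤ ℤ.≤ i × Odd i) y

WeightedSum : (n : ℕ) → Pred (ℕ × ℕ) 0ℓ
WeightedSum n (a , b) = a ℕ.+ 2 ℕ.* b ≡ n

filterFinite : {A : Set} {P : Pred A 0ℓ} → Decidable P → (xs : List A) → Unique xs →
               (∀ {x} → P x → x ∈ xs) → Finite P
filterFinite P? xs u c = record
  { elements = filter P? xs
  ; unique   = Unique.filter⁺ P? u
  ; sound    = λ x∈ → proj₂ (∈-filter⁻ P? {xs = xs} x∈)
  ; complete = λ p → ∈-filter⁺ P? (c p) p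
  }

vectors : {A : Set} → List A → (j : ℕ) → List (Vec A j)
vectors xs zero    = [] ∷ []
vectors xs (suc j) = cartesianProductWith _∷_ xs (vectors xs j)

vectors-unique : {A : Set} {xs : List A} → Unique xs → ∀ j → Unique (vectors xs j)
vectors-unique u zero    = ListAll.[] AllPairs.∷ AllPairs.[]
vectors-unique u (suc j) = Unique.cartesianProductWith⁺ _∷_ ∷-injective u (vectors-unique u j)

vectors-complete : {A : Set} {xs : List A} {j : ℕ} {v : Vec A j} →
                   All (_∈ xs) v → v ∈ vectors xs j
vectors-complete []       = here refl
vectors-complete (p ∷ ps) = ∈-cartesianProductWith⁺ _∷_ p (vectors-complete ps)

-- The integers of absolute value at most m.
interval : ℕ → List ℤ
interval m = List.map +_ (upTo (suc m)) ++ List.map -[1+_] (upTo m)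

interval-unique : ∀ m → Unique (interval m)
interval-unique m = Unique.++⁺
  (Unique.map⁺ ℤ.+-injective (Unique.upTo⁺ (suc m)))
  (Unique.map⁺ ℤ.-[1+-injective (Unique.upTo⁺ m))
  λ (p , q) → disjoint (proj₂ (proj₂ (∈-map⁻ +_ p))) (proj₂ (proj₂ (∈-map⁻ -[1+_] q)))
  where
  open import Data.Empty using (⊥)
  disjoint : ∀ {i a b} → i ≡ + a → i ≡ -[1+ b ] → ⊥
  disjoint refl ()

interval-complete : ∀ {m i} → ∣ i ∣ ℕ.≤ m → i ∈ interval m
interval-complete {i = + a}      a≤m = ∈-++⁺ˡ (∈-map⁺ +_ (∈-upTo⁺ (s≤s a≤m)))
interval-complete {m} { -[1+ a ]} a<m =
  ∈-++⁺ʳ (List.map +_ (upTo (suc m))) (∈-map⁺ -[1+_] (∈-upTo⁺ a<m))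

entries≤sum : {A : Set} (size weight : A → ℕ) → (∀ x → size x ℕ.≤ weight x) →
              ∀ {j} (v : Vec A j) → All (λ x → size x ℕ.≤ Vec.sum (Vec.map weight v)) v
entries≤sum size weight le []      = []
entries≤sum size weight le (x ∷ v) =
  ℕ.≤-trans (le x) (ℕ.m≤m+n (weight x) _) ∷
  All.map (λ p → ℕ.≤-trans p (ℕ.m≤n+m _ (weight x))) (entries≤sum size weight le v)

n≤n^2 : ∀ n → n ℕ.≤ n ℕ.^ 2
n≤n^2 zero    = z≤n
n≤n^2 (suc n) = ℕ.≤-trans (ℕ.m≤m*n (suc n) (suc n)) (ℕ.≤-reflexive (cong (suc n ℕ.*_) (sym (ℕ.*-identityʳ (suc n)))))

n≤triangular : ∀ n → n ℕ.≤ triangular n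
n≤triangular zero    = z≤n
n≤triangular (suc n) = subst (ℕ._≤ triangular (suc n)) (m*n/n≡m (suc n) 2)
  (/-monoˡ-≤ 2 (ℕ.*-monoʳ-≤ (suc n) (ℕ.+-mono-≤ (s≤s (z≤n {n})) (ℕ.≤-refl {1}))))

i^2≡∣i∣^2 : ∀ i → i ℤ.^ 2 ≡ + (∣ i ∣ ℕ.^ 2)
i^2≡∣i∣^2 (+ a) = trans (cong (+ a ℤ.*_) (sym (ℤ.pos-* a 1))) (sym (ℤ.pos-* a (a ℕ.* 1)))
i^2≡∣i∣^2 -[1+ a ] = refl

sum-squares : ∀ {j} (y : Vec ℤ j) →
              sumℤ (Vec.map (ℤ._^ 2) y) ≡ + Vec.sum (Vec.map (λ i → ∣ i ∣ ℕ.^ 2) y)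
sum-squares []      = refl
sum-squares (i ∷ y) = trans (cong₂ ℤ._+_ (i^2≡∣i∣^2 i) (sum-squares y)) (sym (ℤ.pos-+ (∣ i ∣ ℕ.^ 2) _))

SquareRep-bounded : ∀ {j m} {y : Vec ℤ j} → SquareRep j m y → y ∈ vectors (interval m) j
SquareRep-bounded {y = y} eq = vectors-complete (All.map
  (λ p → interval-complete (subst (_ ℕ.≤_) (sym (ℤ.+-injective (trans eq (sum-squares y)))) p))
  (entries≤sum ∣_∣ (λ i → ∣ i ∣ ℕ.^ 2) (λ i → n≤n^2 ∣ i ∣) y))

squareRep? : ∀ j m → Decidable (SquareRep j m)
squareRep? j m y = + m ℤ.≟ sumℤ (Vec.map (ℤ._^ 2) y)

oddSquareRep? : ∀ j m → Decidable (OddSquareRep j m)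
oddSquareRep? j m y =
  squareRep? j m y ×-dec All.all? (λ i → (0ℤ ℤ.≤? i) ×-dec ¬? (2 ℕ.∣? ∣ i ∣)) y

squareReps : ∀ j m → Finite (SquareRep j m)
squareReps j m = filterFinite (squareRep? j m) (vectors (interval m) j)
  (vectors-unique (interval-unique m) j) SquareRep-bounded

oddSquareReps : ∀ j m → Finite (OddSquareRep j m)
oddSquareReps j m = filterFinite (oddSquareRep? j m) (vectors (interval m) j)
  (vectors-unique (interval-unique m) j) (λ p → SquareRep-bounded (proj₁ p))

triangularReps : ∀ j m → Finite (TriangularRep j m)
triangularReps j m = filterFinite (λ z → m ℕ.≟ Vec.sum (Vec.map triangular z))
  (vectors (upTo (suc m)) j) (vectors-unique (Unique.upTo⁺ (suc m)) j)
  λ {z} eq → vectors-complete (All.map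
    (λ p → ∈-upTo⁺ (s≤s (subst (_ ℕ.≤_) (sym eq) p)))
    (entries≤sum (λ a → a) triangular n≤triangular z))

weightedSums : ∀ n → Finite (WeightedSum n)
weightedSums n = filterFinite (λ (a , b) → a ℕ.+ 2 ℕ.* b ℕ.≟ n)
  (cartesianProduct (upTo (suc n)) (upTo (suc n)))
  (Unique.cartesianProduct⁺ (Unique.upTo⁺ (suc n)) (Unique.upTo⁺ (suc n)))
  λ { {a , b} refl → ∈-cartesianProduct⁺
        (∈-upTo⁺ (s≤s (ℕ.m≤m+n a (2 ℕ.* b))))
        (∈-upTo⁺ (s≤s (ℕ.≤-trans (ℕ.m≤n*m b 2) (ℕ.m≤n+m (2 ℕ.* b) a)))) }

r : (j m : ℕ) → ℕ
r j m = # (squareReps j m)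

δ : (j m : ℕ) → ℕ
δ j m = # (triangularReps j m)

q : (j m : ℕ) → ℕ
q j m = # (oddSquareReps j m)

{-# OPTIONS --safe #-}

-- Odd squares correspond to triangular numbers T n = n (n + 1) / 2 by (2 n + 1)² = 8 T n + 1.
-- For the convolution, extend T to ℤ: it is invariant under the reflection i ↦ −1 − i, so
-- every T i is T (fold i) for a unique natural number fold i ∈ {i, −1 − i}.  Since
-- T (z + y) + T (z − y) = y² + 2 T z, the map (y , z) ↦ (fold (z + y) , fold (z − y)) from
-- ℤ × ℕ to ℕ × ℕ carries the weight y² + 2 T z to the sum of two triangular numbers, and it
-- is a bijection.  Apply it coordinatewise to vectors of length k and sort the pairs of
-- vectors by their weights.
module Submission where

open import Defs
open import Data.Nat using (ℕ; zero; suc; _+_; _*_; _^_; NonZero; z≤n)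
open import Data.Nat.Divisibility using (_∣_; divides; m∣m*n; ∣m∣n⇒∣m+n)
open import Data.Nat.DivMod using (m/n*n≡m)
import Data.Nat.Properties as ℕ
import Data.Nat.Tactic.RingSolver as ℕ-Solver
open import Data.Integer as ℤ using (ℤ; +_; -[1+_]; 0ℤ; 1ℤ; -1ℤ; ∣_∣)
import Data.Integer.Properties as ℤ
import Data.Integer.Tactic.RingSolver as ℤ-Solver
open import Data.List as List using (List; []; _∷_; length; concatMap; cartesianProduct)
import Data.List.Properties as List
open import Data.List.Membership.Propositional using (_∈_; lose; find)
open import Data.List.Membership.Propositional.Properties
  using (∈-map⁺; ∈-map⁻; ∈-concatMap⁺; ∈-concatMap⁻; ∈-cartesianProduct⁺; ∈-cartesianProduct⁻)
open import Data.List.Membership.Propositional.Properties.WithK using (unique∧set⇒bag)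
open import Data.List.Relation.Binary.BagAndSetEquality using (∼bag⇒↭)
open import Data.List.Relation.Binary.Permutation.Propositional.Properties using (↭-length)
import Data.List.Relation.Unary.All as ListAll
import Data.List.Relation.Unary.All.Properties as ListAll
import Data.List.Relation.Unary.AllPairs as AllPairs
import Data.List.Relation.Unary.AllPairs.Properties as AllPairs
import Data.List.Relation.Unary.Unique.Propositional.Properties as Unique
open import Data.Nat.ListAction using (sum)
open import Data.Product using (_×_; _,_; ∃; ∃₂)
open import Data.Sum using (_⊎_; inj₁; inj₂)
open import Data.Vec as Vec using (Vec; []; _∷_)
import Data.Vec.Properties as Vec
open import Data.Vec.Relation.Unary.All using (All; []; _∷_)
open import Function using (_∘_; mk⇔)
open import Level using (0ℓ)
open import Relation.Binary.PropositionalEquality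
open import Relation.Nullary using (contradiction)
open import Relation.Unary using (Pred)

-- Counting

#-bijection : {A B : Set} {P : Pred A 0ℓ} {Q : Pred B 0ℓ} (F : Finite P) (G : Finite Q)
              (f : A → B) → (∀ {x y} → f x ≡ f y → x ≡ y) → (∀ {x} → P x → Q (f x)) →
              (∀ {y} → Q y → ∃ λ x → P x × f x ≡ y) → # F ≡ # G
#-bijection {B = B} F G f injective preserves surjective = begin
  length (elements F)              ≡⟨ List.length-map f (elements F) ⟨
  -- The image list and `elements G` have no duplicates and the same members, so they are
  -- permutations of each other.
  length (List.map f (elements F)) ≡⟨ ↭-length (∼bag⇒↭
    (unique∧set⇒bag (Unique.map⁺ injective (unique F)) (unique G) (mk⇔ to from))) ⟩
  length (elements G)              ∎
  where
  open ≡-Reasoning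
  to : ∀ {y} → y ∈ List.map f (elements F) → y ∈ elements G
  to y∈ with x , x∈ , refl ← ∈-map⁻ f y∈ = complete G (preserves (sound F x∈))
  from : ∀ {y} → y ∈ elements G → y ∈ List.map f (elements F)
  from y∈ with x , p , refl ← surjective (sound G y∈) = ∈-map⁺ f (complete F p)

length-concatMap : {A B : Set} (f : A → List B) (xs : List A) →
                   length (concatMap f xs) ≡ sum (List.map (length ∘ f) xs)
length-concatMap f []       = refl
length-concatMap f (x ∷ xs) = trans (List.length-++ (f x))
  (cong (λ l → length (f x) + l) (length-concatMap f xs))

length-cartesianProduct : {A B : Set} (xs : List A) (ys : List B) →
                          length (cartesianProduct xs ys) ≡ length xs * length ys
length-cartesianProduct []       ys = refl
length-cartesianProduct (x ∷ xs) ys = trans (List.length-++ (List.map (x ,_) ys))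
  (cong₂ _+_ (List.length-map (x ,_) ys) (length-cartesianProduct xs ys))

∑-cong : {A : Set} {P : Pred A 0ℓ} (F : Finite P) {f g : A → ℕ} → f ≗ g → ∑ F f ≡ ∑ F g
∑-cong F f≗g = cong sum (List.map-cong f≗g (elements F))

productFinite : {A B : Set} {P : Pred A 0ℓ} {Q : Pred B 0ℓ} →
                Finite P → Finite Q → Finite (λ (x , y) → P x × Q y)
productFinite F G = record
  { elements = cartesianProduct (elements F) (elements G)
  ; unique   = Unique.cartesianProduct⁺ (unique F) (unique G)
  ; sound    = λ xy∈ → let x∈ , y∈ = ∈-cartesianProduct⁻ (elements F) (elements G) xy∈
                       in sound F x∈ , sound G y∈
  ; complete = λ (p , q) → ∈-cartesianProduct⁺ (complete F p) (complete G q)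
  }

-- Counting by fibres of `h`: `index` makes the lists of distinct indices disjoint, and `own` puts
-- each `x` into the list of its own index. The fibre predicate `R i` is kept apart from `h x ≡ i`
-- so that `G i` may be a product of lists already at hand.
module _ {A I : Set} {P : Pred I 0ℓ} (F : Finite P) (h : A → I) {R : I → Pred A 0ℓ}
         (index : ∀ {i} x → R i x → h x ≡ i) (own : ∀ x → R (h x) x)
         (G : ∀ i → Finite (R i)) where

  fibredFinite : Finite (P ∘ h)
  fibredFinite = record
    { elements = concatMap (elements ∘ G) (elements F)
    ; unique   = Unique.concat⁺
        (ListAll.map⁺ (ListAll.universal (λ i → unique (G i)) (elements F)))
        (AllPairs.map⁺ (AllPairs.map
          (λ {i} {j} i≢j {x} (x∈i , x∈j) →
            i≢j (trans (sym (index x (sound (G i) x∈i))) (index x (sound (G j) x∈j))))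
          (unique F)))
    ; sound    = λ {x} x∈ → let i , i∈ , x∈i = find (∈-concatMap⁻ (elements ∘ G) x∈)
                        in subst P (sym (index x (sound (G i) x∈i))) (sound F i∈)
    ; complete = λ {x} p → ∈-concatMap⁺ (elements ∘ G) (lose (complete F p) (complete (G (h x)) (own x)))
    }

  #-fibredFinite : # fibredFinite ≡ ∑ F (λ i → # (G i))
  #-fibredFinite = length-concatMap (elements ∘ G) (elements F)

-- Triangular numbers

-- Passing from `n` to `suc n` increases the product by the even number `2 * (n + 1)`.
2∣n*[n+1] : ∀ n → 2 ∣ n * (n + 1)
2∣n*[n+1] zero    = divides 0 refl
2∣n*[n+1] (suc n) = subst (2 ∣_) (sym (step n)) (∣m∣n⇒∣m+n (2∣n*[n+1] n) (m∣m*n (n + 1)))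
  where
  step : ∀ n → suc n * (suc n + 1) ≡ n * (n + 1) + 2 * (n + 1)
  step = ℕ-Solver.solve-∀

-- The product is even, so the floor division in `triangular` is exact. Later identities start from
-- this doubled form, where no division occurs.
triangular-double : ∀ n → 2 * triangular n ≡ n * (n + 1)
triangular-double n = trans (ℕ.*-comm 2 (triangular n)) (m/n*n≡m (2∣n*[n+1] n))

-- The sum of squares taken in `ℕ`, so that it can be combined with triangular sums.
norm : ∀ {k} → Vec ℤ k → ℕ
norm = Vec.sum ∘ Vec.map (λ i → ∣ i ∣ ^ 2)

triangularSum : ∀ {k} → Vec ℕ k → ℕ
triangularSum = Vec.sum ∘ Vec.map triangular

SquareRep⇒norm : ∀ {k m} (y : Vec ℤ k) → SquareRep k m y → norm y ≡ m
SquareRep⇒norm y eq = sym (ℤ.+-injective (trans eq (sum-squares y)))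

norm⇒SquareRep : ∀ {k m} (y : Vec ℤ k) → norm y ≡ m → SquareRep k m y
norm⇒SquareRep y refl = sym (sum-squares y)

-- Odd squares

odd : ℕ → ℤ
odd n = + suc (2 * n)

odd-injective : ∀ {m n} → odd m ≡ odd n → m ≡ n
odd-injective {m} {n} eq = ℕ.*-cancelˡ-≡ m n 2 (ℕ.suc-injective (ℤ.+-injective eq))

odd-Odd : ∀ n → Odd (odd n)
-- Divisibility in `ℤ` is divisibility of absolute values, so `eq` is an equation
-- `suc (2 * n) ≡ m * 2` in `ℕ`.
odd-Odd n (divides m eq) = ℕ.even≢odd m n (trans (ℕ.*-comm 2 m) (sym eq))

half : ∀ n → ∃ λ m → n ≡ 2 * m ⊎ n ≡ suc (2 * m)
half zero    = 0 , inj₁ refl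
half (suc n) with half n
... | m , inj₁ refl = m , inj₂ refl
... | m , inj₂ refl = suc m , inj₁ (sym (ℕ.*-suc 2 m))

odd-surjective : ∀ {i} → 0ℤ ℤ.≤ i × Odd i → ∃ λ n → odd n ≡ i
-- The sign hypothesis leaves only the constructor `+_`.
odd-surjective { + m } (_ , i-odd) with half m
... | n , inj₁ refl = contradiction (m∣m*n n) i-odd
... | n , inj₂ refl = n , refl

odd-square : ∀ n → ∣ odd n ∣ ^ 2 ≡ 8 * triangular n + 1
odd-square n = begin
  suc (2 * n) ^ 2                ≡⟨ expand n ⟩
  4 * (n * (n + 1)) + 1          ≡⟨ cong (λ t → 4 * t + 1) (triangular-double n) ⟨
  4 * (2 * triangular n) + 1     ≡⟨ cong (_+ 1) (ℕ.*-assoc 4 2 (triangular n)) ⟨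
  8 * triangular n + 1           ∎
  where
  open ≡-Reasoning
  expand : ∀ n → suc (2 * n) * (suc (2 * n) * 1) ≡ 4 * (n * (n + 1)) + 1
  expand = ℕ-Solver.solve-∀

-- Each of the `k` coordinates contributes the remainder 1 of `odd-square`; together they form the
-- summand `k`.
norm-odd : ∀ {k} (z : Vec ℕ k) → norm (Vec.map odd z) ≡ 8 * triangularSum z + k
norm-odd []      = refl
norm-odd {suc k} (n ∷ z) = trans (cong₂ _+_ (odd-square n) (norm-odd z))
  (regroup (triangular n) (triangularSum z) k)
  where
  regroup : ∀ a b k → (8 * a + 1) + (8 * b + k) ≡ 8 * (a + b) + suc k
  regroup = ℕ-Solver.solve-∀

map-injective : ∀ {A B : Set} {f : A → B} → (∀ {x y} → f x ≡ f y → x ≡ y) →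
                ∀ {k} {u v : Vec A k} → Vec.map f u ≡ Vec.map f v → u ≡ v
map-injective inj {u = []}    {[]}    _  = refl
map-injective inj {u = _ ∷ _} {_ ∷ _} eq =
  cong₂ _∷_ (inj (Vec.∷-injectiveˡ eq)) (map-injective inj (Vec.∷-injectiveʳ eq))

map-odd-All : ∀ {k} (z : Vec ℕ k) → All (λ i → 0ℤ ℤ.≤ i × Odd i) (Vec.map odd z)
map-odd-All []      = []
map-odd-All (n ∷ z) = (ℤ.+≤+ z≤n , odd-Odd n) ∷ map-odd-All z

map-odd-surjective : ∀ {k} {y : Vec ℤ k} → All (λ i → 0ℤ ℤ.≤ i × Odd i) y →
                     ∃ λ z → Vec.map odd z ≡ y
map-odd-surjective []       = [] , refl
map-odd-surjective (p ∷ ps) with odd-surjective p | map-odd-surjective ps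
... | n , refl | z , refl = n ∷ z , refl

-- `Vec.map odd` multiplies the weight by 8 and adds `k`, and its image consists of exactly the
-- vectors with nonnegative odd entries.
δ≡q : ∀ k n → δ k n ≡ q k (8 * n + k)
δ≡q k n = #-bijection (triangularReps k n) (oddSquareReps k (8 * n + k)) (Vec.map odd)
  (map-injective odd-injective)
  (λ { {z} refl → norm⇒SquareRep (Vec.map odd z) (norm-odd z) , map-odd-All z })
  λ (y-rep , y-odd) → surjective y-rep (map-odd-surjective y-odd)
  where
  surjective : ∀ {y} → SquareRep k (8 * n + k) y → (∃ λ z → Vec.map odd z ≡ y) →
               ∃ λ z → TriangularRep k n z × Vec.map odd z ≡ y
  surjective y-rep (z , refl) = z , ℕ.*-cancelˡ-≡ n (triangularSum z) 8 (ℕ.+-cancelʳ-≡ k _ _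
    (trans (sym (SquareRep⇒norm (Vec.map odd z) y-rep)) (norm-odd z))) , refl

-- Pairs of triangular numbers

-- Since `-[1+ n ]` is -1 - n, dropping the constructor picks the nonnegative member of {i, -1 - i}.
fold : ℤ → ℕ
fold (+ n)    = n
fold -[1+ n ] = n

fold-triangular : ∀ i → + (2 * triangular (fold i)) ≡ i ℤ.* (i ℤ.+ 1ℤ)
fold-triangular (+ n)    = trans (cong +_ (triangular-double n)) (ℤ.pos-* n (n + 1))
fold-triangular -[1+ n ] = begin
  + (2 * triangular n)                       ≡⟨ cong +_ (triangular-double n) ⟩
  + (n * (n + 1))                            ≡⟨ ℤ.pos-* n (n + 1) ⟩
  -- `ℤ.- (1ℤ ℤ.+ + n)` computes to `-[1+ n ]`, and x (x + 1) is invariant under x ↦ -1 - x.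
  + n ℤ.* (+ n ℤ.+ 1ℤ)                       ≡⟨ reflect (+ n) ⟩
  ℤ.- (1ℤ ℤ.+ + n) ℤ.* (ℤ.- (1ℤ ℤ.+ + n) ℤ.+ 1ℤ) ∎
  where
  open ≡-Reasoning
  reflect : ∀ x → x ℤ.* (x ℤ.+ 1ℤ) ≡ ℤ.- (1ℤ ℤ.+ x) ℤ.* (ℤ.- (1ℤ ℤ.+ x) ℤ.+ 1ℤ)
  reflect = ℤ-Solver.solve-∀

-- The fibres of `fold` are the orbits of the reflection: the second alternative says j = -1 - i.
fold-≡ : ∀ i j → fold i ≡ fold j → i ≡ j ⊎ i ℤ.+ j ≡ -1ℤ
fold-≡ (+ m)    (+ m)    refl = inj₁ refl
fold-≡ -[1+ m ] -[1+ m ] refl = inj₁ refl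
fold-≡ (+ m)    -[1+ m ] refl = inj₂ (cancel (+ m))
  where
  cancel : ∀ x → x ℤ.+ ℤ.- (1ℤ ℤ.+ x) ≡ -1ℤ
  cancel = ℤ-Solver.solve-∀
fold-≡ -[1+ m ] (+ m)    refl = inj₂ (cancel (+ m))
  where
  cancel : ∀ x → ℤ.- (1ℤ ℤ.+ x) ℤ.+ x ≡ -1ℤ
  cancel = ℤ-Solver.solve-∀

plus minus : ℤ → ℕ → ℕ
plus  y z = fold (+ z ℤ.+ y)
minus y z = fold (+ z ℤ.- y)

plus-minus-triangular : ∀ y z → triangular (plus y z) + triangular (minus y z)
                            ≡ ∣ y ∣ ^ 2 + 2 * triangular z
plus-minus-triangular y z = ℕ.*-cancelˡ-≡ _ (∣ y ∣ ^ 2 + 2 * triangular z) 2 (ℤ.+-injective (begin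
  + (2 * (triangular (plus y z) + triangular (minus y z)))
    ≡⟨ cong +_ (ℕ.*-distribˡ-+ 2 (triangular (plus y z)) _) ⟩
  + (2 * triangular (plus y z)) ℤ.+ + (2 * triangular (minus y z))
    ≡⟨ cong₂ ℤ._+_ (fold-triangular (+ z ℤ.+ y)) (fold-triangular (+ z ℤ.- y)) ⟩
  (+ z ℤ.+ y) ℤ.* (+ z ℤ.+ y ℤ.+ 1ℤ) ℤ.+ (+ z ℤ.- y) ℤ.* (+ z ℤ.- y ℤ.+ 1ℤ)
    -- The terms in z y and the linear terms in y cancel between the two products, leaving 2 y² + 2
    -- z (z + 1).
    ≡⟨ expand y (+ z) ⟩
  + 2 ℤ.* (y ℤ.^ 2 ℤ.+ + z ℤ.* (+ z ℤ.+ 1ℤ))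
    ≡⟨ cong₂ (λ s t → + 2 ℤ.* (s ℤ.+ t)) (i^2≡∣i∣^2 y) (sym (fold-triangular (+ z))) ⟩
  + 2 ℤ.* + (∣ y ∣ ^ 2 + 2 * triangular z)
    ≡⟨ ℤ.pos-* 2 (∣ y ∣ ^ 2 + 2 * triangular z) ⟨
  + (2 * (∣ y ∣ ^ 2 + 2 * triangular z)) ∎))
  where
  open ≡-Reasoning
  expand : ∀ y z → (z ℤ.+ y) ℤ.* (z ℤ.+ y ℤ.+ 1ℤ) ℤ.+ (z ℤ.+ ℤ.- y) ℤ.* (z ℤ.+ ℤ.- y ℤ.+ 1ℤ)
                   ≡ + 2 ℤ.* (y ℤ.* (y ℤ.* 1ℤ) ℤ.+ z ℤ.* (z ℤ.+ 1ℤ))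
  expand = ℤ-Solver.solve-∀

i+i≢1 : ∀ i → i ℤ.+ i ≢ 1ℤ
-- Only positive `i` needs an argument; for zero and negative `i` the two sides are distinct
-- constructor forms.
i+i≢1 (+ suc n) eq = ℕ.m+1+n≢0 n (ℕ.suc-injective (ℤ.+-injective eq))

i+i-injective : ∀ {i j} → i ℤ.+ i ≡ j ℤ.+ j → i ≡ j
i+i-injective {i} {j} eq = ℤ.*-cancelˡ-≡ (+ 2) i j (trans (double i) (trans eq (sym (double j))))
  where
  double : ∀ i → + 2 ℤ.* i ≡ i ℤ.+ i
  double = ℤ-Solver.solve-∀

-- Passing from (y , z) to (y′ , z′), each of z + y, z − y is kept or reflected.  Parity rules
-- out that exactly one is reflected; if both are, then z + z′ = −1.
plus-minus-injective : ∀ y z y′ z′ → plus y z ≡ plus y′ z′ → minus y z ≡ minus y′ z′ →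
                       y ≡ y′ × z ≡ z′
plus-minus-injective y z y′ z′ p m
  with fold-≡ (+ z ℤ.+ y) (+ z′ ℤ.+ y′) p | fold-≡ (+ z ℤ.- y) (+ z′ ℤ.- y′) m
... | inj₁ p₁ | inj₁ m₁ =
      i+i-injective (trans (difference y (+ z)) (trans (cong₂ ℤ._-_ p₁ m₁) (sym (difference y′ (+ z′)))))
    , ℤ.+-injective (i+i-injective (trans (total y (+ z)) (trans (cong₂ ℤ._+_ p₁ m₁) (sym (total y′ (+ z′))))))
  where
  difference : ∀ y z → y ℤ.+ y ≡ (z ℤ.+ y) ℤ.+ ℤ.- (z ℤ.+ ℤ.- y)
  difference = ℤ-Solver.solve-∀
  total : ∀ y z → z ℤ.+ z ≡ (z ℤ.+ y) ℤ.+ (z ℤ.+ ℤ.- y)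
  total = ℤ-Solver.solve-∀
-- Twice y - z′ is the vanishing difference from `p₁` minus the sum -1 from `m₂`, hence 1.
... | inj₁ p₁ | inj₂ m₂ = contradiction
      (trans (parity y (+ z) y′ (+ z′)) (cong₂ ℤ._-_ (ℤ.i≡j⇒i-j≡0 p₁) m₂))
      (i+i≢1 (y ℤ.- + z′))
  where
  parity : ∀ y z y′ z′ → (y ℤ.+ ℤ.- z′) ℤ.+ (y ℤ.+ ℤ.- z′)
           ≡ ((z ℤ.+ y) ℤ.+ ℤ.- (z′ ℤ.+ y′)) ℤ.+ ℤ.- ((z ℤ.+ ℤ.- y) ℤ.+ (z′ ℤ.+ ℤ.- y′))
  parity = ℤ-Solver.solve-∀
... | inj₂ p₂ | inj₁ m₁ = contradiction
      (trans (parity y (+ z) y′ (+ z′)) (cong₂ ℤ._-_ (ℤ.i≡j⇒i-j≡0 m₁) p₂))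
      (i+i≢1 (ℤ.- y ℤ.- + z′))
  where
  parity : ∀ y z y′ z′ → (ℤ.- y ℤ.+ ℤ.- z′) ℤ.+ (ℤ.- y ℤ.+ ℤ.- z′)
           ≡ ((z ℤ.+ ℤ.- y) ℤ.+ ℤ.- (z′ ℤ.+ ℤ.- y′)) ℤ.+ ℤ.- ((z ℤ.+ y) ℤ.+ (z′ ℤ.+ y′))
  parity = ℤ-Solver.solve-∀
... | inj₂ p₂ | inj₂ m₂ = contradiction
      (trans (total y (+ z) y′ (+ z′)) (cong₂ ℤ._+_ p₂ m₂)) λ ()
  where
  total : ∀ y z y′ z′ → (z ℤ.+ z′) ℤ.+ (z ℤ.+ z′)
          ≡ ((z ℤ.+ y) ℤ.+ (z′ ℤ.+ y′)) ℤ.+ ((z ℤ.+ ℤ.- y) ℤ.+ (z′ ℤ.+ ℤ.- y′))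
  total = ℤ-Solver.solve-∀

plus-minus-surjective-≤ : ∀ b d → ∃₂ λ y z → plus y z ≡ b + d × minus y z ≡ b
plus-minus-surjective-≤ b d with half d
-- For d = 2 e nothing is reflected: z + y = b + d and z - y = b give y = e and z = b + e.
... | e , inj₁ refl = + e , b + e , even b e , cong fold (cancel (+ b) (+ e))
  where
  even : ∀ b e → b + e + e ≡ b + 2 * e
  even = ℕ-Solver.solve-∀
  cancel : ∀ b e → b ℤ.+ e ℤ.+ ℤ.- e ≡ b
  cancel = ℤ-Solver.solve-∀
-- For d = 2 e + 1 that system has no integer solution, so the smaller value is reflected: z + y = b
-- + d and z - y = -1 - b give z = e and y = b + e + 1.
... | e , inj₂ refl = + suc (b + e) , e , odd-sum b e , cong fold (cancel (+ b) (+ e))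
  where
  odd-sum : ∀ b e → e + suc (b + e) ≡ b + suc (2 * e)
  odd-sum = ℕ-Solver.solve-∀
  cancel : ∀ b e → e ℤ.+ ℤ.- (1ℤ ℤ.+ (b ℤ.+ e)) ≡ ℤ.- (1ℤ ℤ.+ b)
  cancel = ℤ-Solver.solve-∀

plus-minus-surjective : ∀ a b → ∃₂ λ y z → plus y z ≡ a × minus y z ≡ b
plus-minus-surjective a b with ℕ.≤-total b a
... | inj₁ b≤a with d , refl ← ℕ.m≤n⇒∃[o]m+o≡n b≤a = plus-minus-surjective-≤ b d
-- Replacing y by -y exchanges `plus` and `minus`, which reduces this order to the other one.
... | inj₂ a≤b with d , refl ← ℕ.m≤n⇒∃[o]m+o≡n a≤b
               with y , z , p , m ← plus-minus-surjective-≤ a d =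
  ℤ.- y , z , m , trans (cong (λ i → fold (+ z ℤ.+ i)) (ℤ.neg-involutive y)) p

-- Pairs of vectors and the convolution

split : ∀ {k} → Vec ℤ k × Vec ℕ k → Vec ℕ (k + k)
split (y , z) = Vec.zipWith plus y z Vec.++ Vec.zipWith minus y z

zipWith-plus-minus-injective : ∀ {k} (y : Vec ℤ k) (z : Vec ℕ k) (y′ : Vec ℤ k) (z′ : Vec ℕ k) →
                    Vec.zipWith plus y z ≡ Vec.zipWith plus y′ z′ →
                    Vec.zipWith minus y z ≡ Vec.zipWith minus y′ z′ → (y , z) ≡ (y′ , z′)
zipWith-plus-minus-injective []      []      []        []        _ _ = refl
zipWith-plus-minus-injective (i ∷ y) (n ∷ z) (i′ ∷ y′) (n′ ∷ z′) p m
  with plus-minus-injective i n i′ n′ (Vec.∷-injectiveˡ p) (Vec.∷-injectiveˡ m)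
     | zipWith-plus-minus-injective y z y′ z′ (Vec.∷-injectiveʳ p) (Vec.∷-injectiveʳ m)
... | refl , refl | refl = refl

split-injective : ∀ {k} {x x′ : Vec ℤ k × Vec ℕ k} → split x ≡ split x′ → x ≡ x′
split-injective {x = y , z} {y′ , z′} eq
  with p , m ← Vec.++-injective (Vec.zipWith plus y z) (Vec.zipWith plus y′ z′) eq =
  zipWith-plus-minus-injective y z y′ z′ p m

zipWith-plus-minus-surjective : ∀ {k} (u v : Vec ℕ k) →
                     ∃₂ λ y z → Vec.zipWith plus y z ≡ u × Vec.zipWith minus y z ≡ v
zipWith-plus-minus-surjective []      []      = [] , [] , refl , refl
zipWith-plus-minus-surjective (a ∷ u) (b ∷ v)
  with plus-minus-surjective a b | zipWith-plus-minus-surjective u v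
... | i , n , refl , refl | y , z , refl , refl = i ∷ y , n ∷ z , refl , refl

split-surjective : ∀ {k} (w : Vec ℕ (k + k)) → ∃ λ x → split x ≡ w
split-surjective {k} w with u , v , refl ← Vec.splitAt k w
                       with y , z , refl , refl ← zipWith-plus-minus-surjective u v = (y , z) , refl

triangularSum-++ : ∀ {j k} (u : Vec ℕ j) (v : Vec ℕ k) →
                   triangularSum (u Vec.++ v) ≡ triangularSum u + triangularSum v
triangularSum-++ u v = trans (cong Vec.sum (Vec.map-++ triangular u v)) (Vec.sum-++ (Vec.map triangular u))

triangularSum-zipWith-plus-minus : ∀ {k} (y : Vec ℤ k) (z : Vec ℕ k) →
  triangularSum (Vec.zipWith plus y z) + triangularSum (Vec.zipWith minus y z)
  ≡ norm y + 2 * triangularSum z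
triangularSum-zipWith-plus-minus []      []      = refl
triangularSum-zipWith-plus-minus (i ∷ y) (n ∷ z) = begin
  (triangular (plus i n) + triangularSum (Vec.zipWith plus y z)) +
  (triangular (minus i n) + triangularSum (Vec.zipWith minus y z))
    ≡⟨ interchange (triangular (plus i n)) _ _ _ ⟩
  (triangular (plus i n) + triangular (minus i n)) +
  (triangularSum (Vec.zipWith plus y z) + triangularSum (Vec.zipWith minus y z))
    ≡⟨ cong₂ _+_ (plus-minus-triangular i n) (triangularSum-zipWith-plus-minus y z) ⟩
  (∣ i ∣ ^ 2 + 2 * triangular n) + (norm y + 2 * triangularSum z)
    ≡⟨ regroup (∣ i ∣ ^ 2) (triangular n) (norm y) (triangularSum z) ⟩
  norm (i ∷ y) + 2 * triangularSum (n ∷ z) ∎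
  where
  open ≡-Reasoning
  interchange : ∀ a b c d → (a + b) + (c + d) ≡ (a + c) + (b + d)
  interchange = ℕ-Solver.solve-∀
  regroup : ∀ a b c d → (a + 2 * b) + (c + 2 * d) ≡ (a + c) + 2 * (b + d)
  regroup = ℕ-Solver.solve-∀

triangularSum-split : ∀ {k} (y : Vec ℤ k) (z : Vec ℕ k) →
                      triangularSum (split (y , z)) ≡ norm y + 2 * triangularSum z
triangularSum-split y z =
  trans (triangularSum-++ (Vec.zipWith plus y z) _) (triangularSum-zipWith-plus-minus y z)

-- The pairs (y , z) with `norm y + 2 * triangularSum z ≡ n` are counted in two ways: `split`
-- matches them with the triangular representations of length `k + k`, and sorting them by `weights`
-- gives the convolution.
δ[k+k]≡∑r*δ : ∀ k n → δ (k + k) n ≡ ∑ (weightedSums n) (λ (a , b) → r k a * δ k b)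
δ[k+k]≡∑r*δ k n = begin
  δ (k + k) n
    ≡⟨ #-bijection mixedReps (triangularReps (k + k) n) split split-injective
         (λ { {y , z} refl → sym (triangularSum-split y z) }) (λ {w} → surjective w) ⟨
  # mixedReps
    ≡⟨ #-fibredFinite (weightedSums n) weights {Reps} index own reps ⟩
  ∑ (weightedSums n) (λ ab → # (reps ab))
    ≡⟨ ∑-cong (weightedSums n) (λ (a , b) →
         length-cartesianProduct (elements (squareReps k a)) (elements (triangularReps k b))) ⟩
  ∑ (weightedSums n) (λ (a , b) → r k a * δ k b) ∎
  where
  open ≡-Reasoning
  weights : Vec ℤ k × Vec ℕ k → ℕ × ℕ
  weights (y , z) = norm y , triangularSum z
  Reps : ℕ × ℕ → Pred (Vec ℤ k × Vec ℕ k) 0ℓ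
  Reps (a , b) (y , z) = SquareRep k a y × TriangularRep k b z
  reps : ∀ ab → Finite (Reps ab)
  reps (a , b) = productFinite (squareReps k a) (triangularReps k b)
  index : ∀ {ab} yz → Reps ab yz → weights yz ≡ ab
  index (y , _) (p , q) = cong₂ _,_ (SquareRep⇒norm y p) (sym q)
  own : ∀ yz → Reps (weights yz) yz
  own (y , _) = norm⇒SquareRep y refl , refl
  mixedReps : Finite (WeightedSum n ∘ weights)
  mixedReps = fibredFinite (weightedSums n) weights {Reps} index own reps
  surjective : ∀ w → TriangularRep (k + k) n w →
               ∃ λ yz → WeightedSum n (weights yz) × split yz ≡ w
  surjective w refl with (y , z) , refl ← split-surjective {k} w =
    (y , z) , sym (triangularSum-split y z) , refl

corollary1p7 : (k : ℕ) .{{_ : NonZero k}} (n : ℕ) →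
    q (2 * k) (8 * n + 2 * k) ≡ δ (2 * k) n
    × δ (2 * k) n ≡ ∑ (weightedSums n) (λ (a , b) → r k a * δ k b)
    × ∑ (weightedSums n) (λ (a , b) → r k a * δ k b)
    ≡ ∑ (weightedSums n) (λ (a , b) → r k a * q k (8 * b + k))
corollary1p7 k n =
    sym (δ≡q (2 * k) n)
  -- `2 * k` computes to `k + (k + 0)`, so the trailing zero has to be removed first.
  , trans (cong (λ j → δ (k + j) n) (ℕ.+-identityʳ k)) (δ[k+k]≡∑r*δ k n)
  , ∑-cong (weightedSums n) (λ (a , b) → cong (r k a *_) (δ≡q k b))
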